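{- (i) For every diameter-critical graph $G$ with diameter at least 3, having $n$ vertices and $m$ edges, the average edge-degree is at most $n$; equivalently $\sum_{v\in V(G)} d_v^2 \le nm$. (ii) For each fixed integer $k\ge 3$ there is an infinite family of diameter-$k$-critical graphs whose average edge-degree is at least $(1-o(1))$ times their number of vertices, where $o(1)\to 0$ as the number of vertices tends to infinity.
   Context: All graphs are finite and simple. $d_G(x,y)$ denotes the length of a shortest $(x,y)$-path ($\infty$ if none exists), and the diameter of $G$ is the maximum of $d_G(x,y)$ over all vertex pairs. A graph $G$ is diameter-critical if for every edge $e$ the graph $G-e$ has strictly larger diameter than $G$; it is diameter-$k$-critical if moreover its diameter is $k$. The edge-degree of an edge $uv$ is $d_u+d_v$; the average edge-degree is its mean over all edges, equal to $\frac1m\sum_v d_v^2$. -}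

module Defs where

open import Data.Nat using (ℕ; zero; suc; _+_; _*_; _<_; _≤_; _<ᵇ_)
open import Data.Fin using (Fin; toℕ; _≟_)
open import Data.List using (List; map; allFin)
open import Data.Nat.ListAction using (sum)
open import Data.Bool using (Bool; true; false; if_then_else_; _∧_; _∨_; not)
open import Data.Product using (Σ; ∃; _×_)
open import Relation.Nullary using (¬_)
open import Relation.Nullary.Decidable using (⌊_⌋)
open import Relation.Binary.PropositionalEquality using (_≡_)

record Graph (n : ℕ) : Set where
  field
    adj    : Fin n → Fin n → Bool
    sym    : ∀ i j → adj i j ≡ adj j i
    irrefl : ∀ i → adj i i ≡ false
open Graph public

Σv : ∀ {n} → (Fin n → ℕ) → ℕ
Σv {n} f = sum (map f (allFin n))

b2n : Bool → ℕ
b2n true  = 1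
b2n false = 0

deg : ∀ {n} → Graph n → Fin n → ℕ
deg G v = Σv (λ w → b2n (adj G v w))

edges : ∀ {n} → Graph n → ℕ
edges G = Σv (λ i → Σv (λ j → if toℕ i <ᵇ toℕ j then b2n (adj G i j) else 0))

sumDegSq : ∀ {n} → Graph n → ℕ
sumDegSq G = Σv (λ v → deg G v * deg G v)

data Within {n : ℕ} (G : Graph n) : ℕ → Fin n → Fin n → Set where
  here : ∀ {ℓ x} → Within G ℓ x x
  step : ∀ {ℓ x z y} → adj G x z ≡ true → Within G ℓ z y → Within G (suc ℓ) x y

-- diam(G) ≤ k   (false for every k if G is disconnected, i.e. diameter ∞)
DiamLE : ∀ {n} → Graph n → ℕ → Set
DiamLE G k = ∀ x y → Within G k x y

HasDiam : ∀ {n} → Graph n → ℕ → Set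
HasDiam G zero    = DiamLE G zero
HasDiam G (suc k) = DiamLE G (suc k) × ¬ DiamLE G k

removeEdge : ∀ {n} (G : Graph n) (u v : Fin n) → Graph n
removeEdge {n} G u v = record { adj = a ; sym = s ; irrefl = r }
  where
  hit : Fin n → Fin n → Bool
  hit i j = (⌊ i ≟ u ⌋ ∧ ⌊ j ≟ v ⌋) ∨ (⌊ i ≟ v ⌋ ∧ ⌊ j ≟ u ⌋)
  a : Fin n → Fin n → Bool
  a i j = adj G i j ∧ not (hit i j)
  open import Relation.Binary.PropositionalEquality using (cong₂; trans; refl)
  open import Data.Bool.Properties using (∧-comm; ∨-comm)
  hit-sym : ∀ i j → hit i j ≡ hit j i
  hit-sym i j = trans (cong₂ _∨_ (∧-comm ⌊ i ≟ u ⌋ ⌊ j ≟ v ⌋) (∧-comm ⌊ i ≟ v ⌋ ⌊ j ≟ u ⌋))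
                      (∨-comm (⌊ j ≟ v ⌋ ∧ ⌊ i ≟ u ⌋) (⌊ j ≟ u ⌋ ∧ ⌊ i ≟ v ⌋))
  s : ∀ i j → a i j ≡ a j i
  s i j = cong₂ (λ x y → x ∧ not y) (sym G i j) (hit-sym i j)
  r : ∀ i → a i i ≡ false
  r i = cong₂ (λ x y → x ∧ not y) (irrefl G i) (refl {x = hit i i})

-- diam(G - e) > diam(G), with ∞ allowed for the left side (diam(G) must be finite)
DiamIncreases : ∀ {n} → Graph n → Graph n → Set
DiamIncreases G H = ∃ λ k → DiamLE G k × ¬ DiamLE H k

DiamCritical : ∀ {n} → Graph n → Set
DiamCritical G = ∀ u v → adj G u v ≡ true → DiamIncreases G (removeEdge G u v)

DiamKCritical : ∀ {n} → ℕ → Graph n → Set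
DiamKCritical k G = DiamCritical G × HasDiam G k

{-# OPTIONS --safe #-}

-- Part (i).  Let T count ordered triangles (u,w,v) and C ordered triples (u,w,z) with uw an edge
-- and z adjacent to neither end.  Inclusion-exclusion gives C + 2 Σ d² = 2nm + T, so it suffices
-- that T ≤ C.  Call v a gate at u towards z ≠ v if some radius contains v, but no other neighbour
-- of u, in the ball around z.  A gate is determined by u and z, and if u,w,v is a triangle then z
-- is adjacent to neither u nor w; so C is at least the sum over triangles of the number of z for
-- which v is a gate at u.  If e = uv lies in a triangle, a critical path x … u v … y for e can be
-- lengthened by only one step to avoid e, hence has length exactly k, and v is a gate at u towards
-- each of its vertices beyond v, as is u at v towards those before u.  These are k - 1 ≥ 2 vertices
-- for the two orientations of e together, so the sum over triangles is at least T.
--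
-- Part (ii).  A path of length k - 1 with many leaves attached at one end is a tree, hence
-- critical, and has m ~ n and Σ d² ~ n².

module Submission where

open import Defs
import Algebra.Properties.Semiring.Sum as SemiringSum
open import Data.Bool using (Bool; true; false; _∨_; not; T; if_then_else_)
import Data.Bool.Properties as Bool
open import Data.Empty using (⊥-elim)
open import Data.Fin using (Fin; zero; suc; toℕ; fromℕ<; _≟_)
open import Data.Fin.Properties using (any?; all?; ¬∀⟶∃¬; toℕ-injective; toℕ-fromℕ<)
  renaming (suc-injective to Fin-suc-injective)
open import Data.List.Properties using (map-tabulate)
open import Data.Nat using (ℕ; zero; suc; _+_; _*_; _≤_; _<_; z≤n; s≤s; s≤s⁻¹; _⊓_; _<ᵇ_)
import Data.Nat as ℕ
import Data.Nat.ListAction as List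
open import Data.Nat.Properties hiding (_≟_)
open import Data.Nat.Tactic.RingSolver using (solve-∀)
open import Data.Product using (Σ; ∃; _×_; _,_; proj₁; proj₂)
open import Data.Sum using (_⊎_; inj₁; inj₂)
open import Function using (_∘_; id)
open import Relation.Binary.Definitions using (tri<; tri≈; tri>)
open import Relation.Binary.PropositionalEquality
  using (_≡_; _≢_; module ≡-Reasoning; refl; trans; cong; cong₂; subst) renaming (sym to ≡-sym)
open import Relation.Nullary using (¬_; Dec; yes; no; ¬?)
open import Relation.Nullary.Decidable using (⌊_⌋; map′; _×-dec_; _⊎-dec_; _→-dec_)

module Sum = SemiringSum +-*-semiring

-- Sums over the vertex set

Σv-suc : ∀ {n} (f : Fin (suc n) → ℕ) → Σv f ≡ f zero + Σv (f ∘ suc)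
Σv-suc {n} f = cong (λ xs → f zero + List.sum xs)
  (trans (map-tabulate suc f) (≡-sym (map-tabulate id (f ∘ suc))))

Σv≡sum : ∀ {n} (f : Fin n → ℕ) → Σv f ≡ Sum.sum f
Σv≡sum {zero}  f = refl
Σv≡sum {suc n} f = trans (Σv-suc f) (cong (f zero +_) (Σv≡sum (f ∘ suc)))

Σv-mono : ∀ {n} {f g : Fin n → ℕ} → (∀ v → f v ≤ g v) → Σv f ≤ Σv g
Σv-mono {zero}          f≤g = z≤n
Σv-mono {suc n} {f} {g} f≤g rewrite Σv-suc f | Σv-suc g =
  +-mono-≤ (f≤g zero) (Σv-mono (f≤g ∘ suc))

Σv-cong : ∀ {n} {f g : Fin n → ℕ} → (∀ v → f v ≡ g v) → Σv f ≡ Σv g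
Σv-cong f≗g = ≤-antisym (Σv-mono (≤-reflexive ∘ f≗g)) (Σv-mono (≤-reflexive ∘ ≡-sym ∘ f≗g))

Σv-distrib-+ : ∀ {n} (f g : Fin n → ℕ) → Σv (λ v → f v + g v) ≡ Σv f + Σv g
Σv-distrib-+ {n} f g rewrite Σv≡sum f | Σv≡sum g =
  trans (Σv≡sum {n} _) (Sum.∑-distrib-+ f g)

*-distribˡ-Σv : ∀ {n} c (f : Fin n → ℕ) → c * Σv f ≡ Σv (λ v → c * f v)
*-distribˡ-Σv {n} c f rewrite Σv≡sum f = trans (Sum.*-distribˡ-sum c f) (≡-sym (Σv≡sum {n} _))

Σv-swap : ∀ {m n} (f : Fin m → Fin n → ℕ) →
          Σv (λ u → Σv (f u)) ≡ Σv (λ v → Σv (λ u → f u v))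
Σv-swap {m} {n} f = begin
  Σv (λ u → Σv (f u))                     ≡⟨ Σv-cong (λ u → Σv≡sum (f u)) ⟩
  Σv (λ u → Sum.sum (f u))                ≡⟨ Σv≡sum {m} _ ⟩
  Sum.sum (λ u → Sum.sum (f u))           ≡⟨ Sum.∑-comm f ⟩
  Sum.sum (λ v → Sum.sum (λ u → f u v))   ≡⟨ Σv≡sum {n} _ ⟨
  Σv (λ v → Sum.sum (λ u → f u v))        ≡⟨ Σv-cong (λ v → Σv≡sum (λ u → f u v)) ⟨
  Σv (λ v → Σv (λ u → f u v))             ∎
  where open ≡-Reasoning

Σv-const : ∀ {n} c → Σv {n} (λ _ → c) ≡ n * c
Σv-const {zero}  c = refl
Σv-const {suc n} c = trans (Σv-suc {n} (λ _ → c)) (cong (c +_) (Σv-const {n} c))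

term≤Σv : ∀ {n} (f : Fin n → ℕ) v → f v ≤ Σv f
term≤Σv f zero    rewrite Σv-suc f = m≤m+n _ _
term≤Σv f (suc v) rewrite Σv-suc f = ≤-trans (term≤Σv (f ∘ suc) v) (m≤n+m _ _)

two-terms≤Σv : ∀ {n} (f : Fin n → ℕ) {u v} → u ≢ v → f u + f v ≤ Σv f
two-terms≤Σv f {zero}  {zero}  u≢v = ⊥-elim (u≢v refl)
two-terms≤Σv f {zero}  {suc v} u≢v rewrite Σv-suc f = +-monoʳ-≤ (f zero) (term≤Σv (f ∘ suc) v)
two-terms≤Σv f {suc u} {zero}  u≢v rewrite Σv-suc f | +-comm (f (suc u)) (f zero) =
  +-monoʳ-≤ (f zero) (term≤Σv (f ∘ suc) u)
two-terms≤Σv f {suc u} {suc v} u≢v rewrite Σv-suc f =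
  ≤-trans (two-terms≤Σv (f ∘ suc) (u≢v ∘ cong suc)) (m≤n+m _ _)

-- Made for charging arguments: once a nonzero term is met, uniqueness makes all later terms vanish.
Σv-subsingleton : ∀ {n} (f : Fin n → ℕ) {c} → (∀ v → f v ≤ c) →
                  (∀ u v → 0 < f u → 0 < f v → u ≡ v) → Σv f ≤ c
Σv-subsingleton {zero}  f f≤c unique = z≤n
Σv-subsingleton {suc n} f {c} f≤c unique rewrite Σv-suc f with f zero in eq
... | zero  = Σv-subsingleton (f ∘ suc) (f≤c ∘ suc)
                (λ u v p q → Fin-suc-injective (unique (suc u) (suc v) p q))
... | suc a = begin
  suc a + Σv (f ∘ suc)          ≤⟨ +-monoʳ-≤ (suc a) (Σv-mono rest≡0) ⟩
  suc a + Σv {n} (λ _ → 0)      ≡⟨ cong (suc a +_) (trans (Σv-const {n} 0) (*-zeroʳ n)) ⟩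
  suc a + 0                     ≡⟨ +-identityʳ _ ⟩
  suc a                         ≡⟨ eq ⟨
  f zero                        ≤⟨ f≤c zero ⟩
  c                             ∎
  where
  open ≤-Reasoning
  rest≡0 : ∀ v → f (suc v) ≤ 0
  rest≡0 v with f (suc v) in eq′
  ... | zero  = z≤n
  ... | suc b with unique zero (suc v) (subst (0 <_) (≡-sym eq) (s≤s z≤n))
                                       (subst (0 <_) (≡-sym eq′) (s≤s z≤n))
  ...   | ()

Σ³ : ∀ {n} → (Fin n → Fin n → Fin n → ℕ) → ℕ
Σ³ f = Σv λ u → Σv λ w → Σv λ z → f u w z

Σ³-mono : ∀ {n} {f g : Fin n → Fin n → Fin n → ℕ} →
          (∀ u w z → f u w z ≤ g u w z) → Σ³ f ≤ Σ³ g
Σ³-mono f≤g = Σv-mono λ u → Σv-mono λ w → Σv-mono λ z → f≤g u w z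

Σ³-cong : ∀ {n} {f g : Fin n → Fin n → Fin n → ℕ} →
          (∀ u w z → f u w z ≡ g u w z) → Σ³ f ≡ Σ³ g
Σ³-cong f≗g = Σv-cong λ u → Σv-cong λ w → Σv-cong λ z → f≗g u w z

Σ³-distrib-+ : ∀ {n} (f g : Fin n → Fin n → Fin n → ℕ) →
               Σ³ (λ u w z → f u w z + g u w z) ≡ Σ³ f + Σ³ g
Σ³-distrib-+ {n} f g = trans
  (Σv-cong λ u → trans (Σv-cong λ w → Σv-distrib-+ (f u w) (g u w)) (Σv-distrib-+ {n} _ _))
  (Σv-distrib-+ {n} _ _)

Σ³-reverse : ∀ {n} (f : Fin n → Fin n → Fin n → ℕ) → Σ³ f ≡ Σ³ (λ u w z → f z w u)
Σ³-reverse {n} f = trans (Σv-cong λ u → Σv-swap (f u))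
  (trans (Σv-swap {n} {n} _) (Σv-cong λ z → Σv-swap λ u w → f u w z))

-- Walks

Within-weaken : ∀ {n} {G : Graph n} {l m x y} → l ≤ m → Within G l x y → Within G m x y
Within-weaken l≤m       here       = here
Within-weaken (s≤s l≤m) (step e p) = step e (Within-weaken l≤m p)

Within-trans : ∀ {n} {G : Graph n} {l m x y z} →
               Within G l x y → Within G m y z → Within G (l + m) x z
Within-trans {l = l} here       q = Within-weaken (m≤n+m _ l) q
Within-trans         (step e p) q = step e (Within-trans p q)

Within-sym : ∀ {n} {G : Graph n} {l x y} → Within G l x y → Within G l y x
Within-sym         here                   = here
Within-sym {G = G} (step {ℓ = l} {x = x} {z} {y} e p) =
  subst (λ m → Within G m y x) (+-comm l 1)
    (Within-trans (Within-sym p) (step (trans (sym G z x) e) here))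

Within-⊆ : ∀ {n} {G H : Graph n} → (∀ a b → adj H a b ≡ true → adj G a b ≡ true) →
           ∀ {l x y} → Within H l x y → Within G l x y
Within-⊆ H⊆G here       = here
Within-⊆ H⊆G (step e p) = step (H⊆G _ _ e) (Within-⊆ H⊆G p)

within? : ∀ {n} (G : Graph n) l x y → Dec (Within G l x y)
within? G zero    x y = map′ (λ { refl → here }) (λ { here → refl }) (x ≟ y)
within? G (suc l) x y = map′
  (λ { (inj₁ refl) → here ; (inj₂ (z , e , p)) → step e p })
  (λ { here → inj₁ refl ; (step e p) → inj₂ (_ , e , p) })
  (x ≟ y ⊎-dec any? λ z → (adj G x z Bool.≟ true) ×-dec within? G l z y)

-- The vertex set is finite and `within?` decides every pair, so the failure of a universal
-- statement yields a witness constructively.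
¬DiamLE⇒far-pair : ∀ {n} (G : Graph n) k → ¬ DiamLE G k → ∃ λ x → ∃ λ y → ¬ Within G k x y
¬DiamLE⇒far-pair {n} G k ¬d with ¬∀⟶∃¬ n _ (λ x → all? (within? G k x)) ¬d
... | x , ¬dx with ¬∀⟶∃¬ n _ (within? G k x) ¬dx
...   | y , ¬w = x , y , ¬w

adj⇒≢ : ∀ {n} (G : Graph n) {u v} → adj G u v ≡ true → u ≢ v
adj⇒≢ G {u} e refl with trans (≡-sym e) (irrefl G u)
... | ()

-- Edge removal

module _ {n} (G : Graph n) (u v : Fin n) where

  removeEdge-⊆ : ∀ a b → adj (removeEdge G u v) a b ≡ true → adj G a b ≡ true
  removeEdge-⊆ a b e with adj G a b
  ... | true  = refl

  removeEdge-removed : adj (removeEdge G u v) u v ≡ false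
  removeEdge-removed with u ≟ u | v ≟ v
  ... | no u≢u | _      = ⊥-elim (u≢u refl)
  ... | yes _  | no v≢v = ⊥-elim (v≢v refl)
  ... | yes _  | yes _  = Bool.∧-zeroʳ (adj G u v)

  removeEdge-split : ∀ a b → adj G a b ≡ true →
    adj (removeEdge G u v) a b ≡ true ⊎ (a ≡ u × b ≡ v) ⊎ (a ≡ v × b ≡ u)
  removeEdge-split a b e with a ≟ u | b ≟ v | a ≟ v | b ≟ u
  ... | yes p | yes q | _     | _     = inj₂ (inj₁ (p , q))
  ... | _     | _     | yes p | yes q = inj₂ (inj₂ (p , q))
  ... | no _  | _     | no _  | _     = inj₁ (trans (Bool.∧-identityʳ _) e)
  ... | no _  | _     | yes _ | no _  = inj₁ (trans (Bool.∧-identityʳ _) e)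
  ... | yes _ | no _  | no _  | _     = inj₁ (trans (Bool.∧-identityʳ _) e)
  ... | yes _ | no _  | yes _ | no _  = inj₁ (trans (Bool.∧-identityʳ _) e)

-- Gates

-- The bound K on the radius only serves to make the predicate decidable.
Gate : ∀ {n} → Graph n → ℕ → Fin n → Fin n → Fin n → Set
Gate G K u v z = z ≢ v × ∃ λ (p : Fin K) → Within G (toℕ p) v z ×
  (∀ v′ → adj G u v′ ≡ true → Within G (toℕ p) v′ z → v′ ≡ v)

gate? : ∀ {n} (G : Graph n) K u v z → Dec (Gate G K u v z)
gate? G K u v z = ¬? (z ≟ v) ×-dec any? λ p → within? G (toℕ p) v z ×-dec
  all? λ v′ → (adj G u v′ Bool.≟ true) →-dec (within? G (toℕ p) v′ z →-dec (v′ ≟ v))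

-- Of the two balls around `z` the smaller lies in the larger, so the gate of the smaller is a
-- neighbour of `u` in the larger and must be its only one.
gate-unique : ∀ {n} {G : Graph n} {K u v v′ z} → adj G u v ≡ true → adj G u v′ ≡ true →
              Gate G K u v z → Gate G K u v′ z → v ≡ v′
gate-unique uv uv′ (_ , p , vz , only-v) (_ , q , v′z , only-v′) with ≤-total (toℕ p) (toℕ q)
... | inj₁ p≤q = only-v′ _ uv (Within-weaken p≤q vz)
... | inj₂ q≤p = ≡-sym (only-v _ uv′ (Within-weaken q≤p v′z))

-- If `u` were adjacent to `z`, then `z` would be a neighbour of `u` in the ball, forcing `z` to be
-- `v`. If `w` were, the ball would contain `w`, forcing `w` to be `v` although `w v` is an edge.
gate⇒nonadjacent : ∀ {n} {G : Graph n} {K u w v z} →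
  adj G u w ≡ true → adj G w v ≡ true → Gate G K u v z →
  adj G u z ≡ false × adj G w z ≡ false
gate⇒nonadjacent {G = G} {z = z} uw wv (z≢v , p , vz , only-v) =
  Bool.¬-not (λ uz → z≢v (only-v z uz here)) ,
  Bool.¬-not (λ wz → adj⇒≢ G wv (only-v _ uw (reach p vz z≢v wz)))
  where
  -- Radius 0 would put `v` at `z`; hence the radius is at least 1 and the ball contains all
  -- neighbours of `z`.
  reach : ∀ {m w v z} (p : Fin m) → Within G (toℕ p) v z → z ≢ v → adj G w z ≡ true →
          Within G (toℕ p) w z
  reach zero    here z≢v wz = ⊥-elim (z≢v refl)
  reach (suc p) _    _   wz = step wz here

gates : ∀ {n} → Graph n → ℕ → Fin n → Fin n → ℕ
gates G K u v = Σv λ z → b2n ⌊ gate? G K u v z ⌋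

-- Double counting of triangles and coedges

module Triangles {n} (G : Graph n) where

  a ā : Fin n → Fin n → ℕ
  a u v = b2n (adj G u v)
  ā u v = b2n (not (adj G u v))

  triangle coedge : Fin n → Fin n → Fin n → ℕ
  triangle u w v = a u w * (a u v * a w v)
  coedge   u w z = a u w * (ā u z * ā w z)

  a-sym : ∀ u v → a u v ≡ a v u
  a-sym u v = cong b2n (sym G u v)

  -- The two ordered pairs on an edge differ in index order, so `up` keeps exactly one of them, the
  -- one that `edges` counts.
  deg-sum : Σv (deg G) ≡ edges G + edges G
  deg-sum = begin
    Σv (λ u → Σv λ v → a u v)                        ≡⟨ Σv-cong (λ u → Σv-cong λ v → split u v) ⟩
    Σv (λ u → Σv λ v → up u v + up v u)              ≡⟨ Σv-cong {n} (λ u → Σv-distrib-+ (up u) (λ v → up v u)) ⟩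
    Σv (λ u → Σv (up u) + Σv (λ v → up v u))         ≡⟨ Σv-distrib-+ {n} _ _ ⟩
    edges G + Σv (λ u → Σv λ v → up v u)             ≡⟨ cong (edges G +_) (Σv-swap {n} {n} _) ⟩
    edges G + edges G                                ∎
    where
    open ≡-Reasoning
    up : Fin n → Fin n → ℕ
    up u v = if toℕ u <ᵇ toℕ v then a u v else 0
    up-yes : ∀ {u v} → toℕ u < toℕ v → up u v ≡ a u v
    up-yes {u} {v} u<v with toℕ u <ᵇ toℕ v in eq
    ... | true  = refl
    ... | false = ⊥-elim (subst T eq (<⇒<ᵇ u<v))
    up-no : ∀ {u v} → ¬ toℕ u < toℕ v → up u v ≡ 0
    up-no {u} {v} u≮v with toℕ u <ᵇ toℕ v in eq
    ... | false = refl
    ... | true  = ⊥-elim (u≮v (<ᵇ⇒< _ _ (subst T (≡-sym eq) _)))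
    split : ∀ u v → a u v ≡ up u v + up v u
    split u v with <-cmp (toℕ u) (toℕ v)
    ... | tri< u<v _ v≮u rewrite up-yes {u} {v} u<v | up-no {v} {u} v≮u = ≡-sym (+-identityʳ _)
    ... | tri> u≮v _ v<u rewrite up-no {u} {v} u≮v | up-yes {v} {u} v<u = a-sym u v
    ... | tri≈ u≮v u≡v v≮u with toℕ-injective u≡v
    ...   | refl rewrite up-no {u} {u} u≮v | irrefl G u = refl

  coedge+degrees : Σ³ coedge + (sumDegSq G + sumDegSq G) ≡
                   n * (edges G + edges G) + Σ³ triangle
  coedge+degrees = begin
    Σ³ coedge + (sumDegSq G + sumDegSq G)
      ≡⟨ cong (Σ³ coedge +_) (cong₂ _+_ first second) ⟨
    Σ³ coedge + (Σ³ (λ u w z → a u w * a u z) + Σ³ (λ u w z → a u w * a w z))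
      ≡⟨ cong (Σ³ coedge +_) (Σ³-distrib-+ {n} _ _) ⟨
    Σ³ coedge + Σ³ (λ u w z → a u w * a u z + a u w * a w z)
      ≡⟨ Σ³-distrib-+ {n} _ _ ⟨
    Σ³ (λ u w z → coedge u w z + (a u w * a u z + a u w * a w z))
      ≡⟨ Σ³-cong (λ u w z → pointwise (adj G u w) (adj G u z) (adj G w z)) ⟩
    Σ³ (λ u w z → a u w + triangle u w z)
      ≡⟨ Σ³-distrib-+ {n} _ _ ⟩
    Σ³ (λ u w z → a u w) + Σ³ triangle
      ≡⟨ cong (_+ Σ³ triangle) total ⟩
    n * (edges G + edges G) + Σ³ triangle ∎
    where
    open ≡-Reasoning
    -- For 0-1 values this reads p((1 - q)(1 - r) + q + r) = p(1 + qr).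
    pointwise : ∀ p q r → b2n p * (b2n (not q) * b2n (not r)) + (b2n p * b2n q + b2n p * b2n r)
                          ≡ b2n p + b2n p * (b2n q * b2n r)
    pointwise false _     _     = refl
    pointwise true  false false = refl
    pointwise true  false true  = refl
    pointwise true  true  false = refl
    pointwise true  true  true  = refl
    first : Σ³ (λ u w z → a u w * a u z) ≡ sumDegSq G
    first = Σv-cong λ u → begin
      Σv (λ w → Σv λ z → a u w * a u z)  ≡⟨ Σv-cong (λ w → *-distribˡ-Σv (a u w) (a u)) ⟨
      Σv (λ w → a u w * deg G u)         ≡⟨ Σv-cong (λ w → *-comm (a u w) (deg G u)) ⟩
      Σv (λ w → deg G u * a u w)         ≡⟨ *-distribˡ-Σv (deg G u) (a u) ⟨
      deg G u * deg G u                  ∎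
    second : Σ³ (λ u w z → a u w * a w z) ≡ sumDegSq G
    second = begin
      Σ³ (λ u w z → a u w * a w z)       ≡⟨ Σv-swap {n} {n} _ ⟩
      Σ³ (λ w u z → a u w * a w z)       ≡⟨ Σ³-cong (λ w u z → cong (_* a w z) (a-sym u w)) ⟩
      Σ³ (λ w u z → a w u * a w z)       ≡⟨ first ⟩
      sumDegSq G                         ∎
    total : Σ³ (λ u w z → a u w) ≡ n * (edges G + edges G)
    total = begin
      Σ³ (λ u w z → a u w)               ≡⟨ Σv-cong (λ u → Σv-cong λ w → Σv-const {n} (a u w)) ⟩
      Σv (λ u → Σv λ w → n * a u w)      ≡⟨ Σv-cong (λ u → *-distribˡ-Σv n (a u)) ⟨
      Σv (λ u → n * deg G u)             ≡⟨ *-distribˡ-Σv n (deg G) ⟨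
      n * Σv (deg G)                     ≡⟨ cong (n *_) deg-sum ⟩
      n * (edges G + edges G)            ∎

  sumDegSq-bound : Σ³ triangle ≤ Σ³ coedge → sumDegSq G ≤ n * edges G
  sumDegSq-bound T≤C = *-cancelˡ-≤ 2 (+-cancelʳ-≤ (Σ³ triangle) _ _ (begin
    2 * sumDegSq G + Σ³ triangle             ≤⟨ +-monoʳ-≤ (2 * sumDegSq G) T≤C ⟩
    2 * sumDegSq G + Σ³ coedge               ≡⟨ lhs (sumDegSq G) (Σ³ coedge) ⟩
    Σ³ coedge + (sumDegSq G + sumDegSq G)    ≡⟨ coedge+degrees ⟩
    n * (edges G + edges G) + Σ³ triangle    ≡⟨ cong (_+ Σ³ triangle) (rhs n (edges G)) ⟩
    2 * (n * edges G) + Σ³ triangle          ∎))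
    where
    open ≤-Reasoning
    lhs : ∀ s c → 2 * s + c ≡ c + (s + s)
    lhs = solve-∀
    rhs : ∀ m e → m * (e + e) ≡ 2 * (m * e)
    rhs = solve-∀

  triangle-positive : ∀ {u w v} {A : Set} (d : Dec A) → 0 < triangle u w v * b2n ⌊ d ⌋ →
    adj G u w ≡ true × adj G u v ≡ true × adj G w v ≡ true × A
  triangle-positive {u} {w} {v} d 0<t with adj G u w | adj G u v | adj G w v | d
  ... | true | true | true | yes x = refl , refl , refl , x

  triangle≤1 : ∀ {u w v} {A : Set} (d : Dec A) → triangle u w v * b2n ⌊ d ⌋ ≤ 1
  triangle≤1 {u} {w} {v} d with adj G u w | adj G u v | adj G w v | d
  ... | false | _     | _     | _     = z≤n
  ... | true  | false | _     | _     = z≤n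
  ... | true  | true  | false | _     = z≤n
  ... | true  | true  | true  | no  _ = z≤n
  ... | true  | true  | true  | yes _ = s≤s z≤n

  coedge-positive : ∀ {u w z} → adj G u w ≡ true → adj G u z ≡ false → adj G w z ≡ false →
                    0 < coedge u w z
  coedge-positive uw uz wz rewrite uw | uz | wz = s≤s z≤n

  triangle-rev : ∀ u w v → triangle v w u ≡ triangle u w v
  triangle-rev u w v rewrite a-sym v w | a-sym v u | a-sym w u = rearrange (a w v) (a u v) (a u w)
    where rearrange : ∀ p q r → p * (q * r) ≡ r * (q * p)
          rearrange = solve-∀

  -- Reversing triangles shows that gates at `u` and gates at `v` contribute the same total `X`. So
  -- `many` gives `Σ³ triangle` ≤ `X`, and `charge` gives `X` ≤ `Σ³ coedge`.
  triangles≤coedges : ∀ K →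
    (∀ u w v → adj G u w ≡ true → adj G u v ≡ true → adj G w v ≡ true →
       2 ≤ gates G K u v + gates G K v u) →
    Σ³ triangle ≤ Σ³ coedge
  triangles≤coedges K many = *-cancelˡ-≤ 2 (begin
    2 * Σ³ triangle
      ≡⟨ double (Σ³ triangle) ⟩
    Σ³ triangle + Σ³ triangle
      ≡⟨ Σ³-distrib-+ triangle triangle ⟨
    Σ³ (λ u w v → triangle u w v + triangle u w v)
      ≤⟨ Σ³-mono enough ⟩
    Σ³ (λ u w v → triangle u w v * gates G K u v + triangle u w v * gates G K v u)
      ≡⟨ Σ³-distrib-+ {n} _ _ ⟩
    X + Σ³ (λ u w v → triangle u w v * gates G K v u)
      ≡⟨ cong (X +_) (Σ³-cong λ u w v → cong (_* gates G K v u) (triangle-rev u w v)) ⟨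
    X + Σ³ (λ u w v → triangle v w u * gates G K v u)
      ≡⟨ cong (X +_) (Σ³-reverse {n} _) ⟨
    X + X
      ≡⟨ double X ⟨
    2 * X
      ≤⟨ *-monoʳ-≤ 2 (Σv-mono λ u → Σv-mono λ w → charge u w) ⟩
    2 * Σ³ coedge ∎)
    where
    open ≤-Reasoning
    X = Σ³ (λ u w v → triangle u w v * gates G K u v)
    double : ∀ x → 2 * x ≡ x + x
    double = solve-∀
    enough : ∀ u w v → triangle u w v + triangle u w v ≤
                       triangle u w v * gates G K u v + triangle u w v * gates G K v u
    enough u w v with adj G u w in uw | adj G u v in uv | adj G w v in wv
    ... | false | _     | _     = z≤n
    ... | true  | false | _     = z≤n
    ... | true  | true  | false = z≤n
    ... | true  | true  | true  rewrite +-identityʳ (gates G K u v) | +-identityʳ (gates G K v u) =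
      many u w v uw uv wv
    term : Fin n → Fin n → Fin n → Fin n → ℕ
    term u w z v = triangle u w v * b2n ⌊ gate? G K u v z ⌋
    term≤coedge : ∀ u w z v → term u w z v ≤ coedge u w z
    term≤coedge u w z v with term u w z v in eq
    ... | zero  = z≤n
    ... | suc t with triangle-positive {u} {w} {v} (gate? G K u v z) (subst (0 <_) (≡-sym eq) (s≤s z≤n))
    ...   | uw , uv , wv , g with gate⇒nonadjacent {u = u} {w} {v} uw wv g
    ...     | uz , wz = ≤-trans (subst (_≤ 1) eq (triangle≤1 {u} {w} {v} (gate? G K u v z)))
                                (coedge-positive uw uz wz)
    -- For fixed `u`, `w` and `z` at most one `v` contributes, and it does so only if `u`, `w`, `z`
    -- form a coedge.
    charge : ∀ u w → Σv (λ v → triangle u w v * gates G K u v) ≤ Σv (coedge u w)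
    charge u w = begin
      Σv (λ v → triangle u w v * gates G K u v)   ≡⟨ Σv-cong (λ v → *-distribˡ-Σv {n} (triangle u w v) _) ⟩
      Σv (λ v → Σv λ z → term u w z v)            ≡⟨ Σv-swap {n} {n} _ ⟩
      Σv (λ z → Σv λ v → term u w z v)            ≤⟨ Σv-mono (λ z → Σv-subsingleton (term u w z)
                                                       (term≤coedge u w z) (unique z)) ⟩
      Σv (coedge u w)                             ∎
      where
      unique : ∀ z v v′ → 0 < term u w z v → 0 < term u w z v′ → v ≡ v′
      unique z v v′ p q
        with triangle-positive {u} {w} {v} (gate? G K u v z) p
           | triangle-positive {u} {w} {v′} (gate? G K u v′ z) q
      ... | _ , uv , _ , g | _ , uv′ , _ , g′ = gate-unique {G = G} {u = u} uv uv′ g g′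

-- Critical edges lying in a triangle

record Bypassed {n} (G H : Graph n) (u v : Fin n) : Set where
  field
    H⊆G    : ∀ a b → adj H a b ≡ true → adj G a b ≡ true
    split  : ∀ a b → adj G a b ≡ true → adj H a b ≡ true ⊎ (a ≡ u × b ≡ v) ⊎ (a ≡ v × b ≡ u)
    bypass : Within H 2 u v

-- `Bypassed` keeps only properties of the edge-deleted graph that are symmetric in the two ends, so
-- one argument serves both orientations of the edge.
Bypassed-sym : ∀ {n} {G H : Graph n} {u v} → Bypassed G H u v → Bypassed G H v u
Bypassed-sym B = record
  { H⊆G = H⊆G ; split = λ a b e → swap (split a b e) ; bypass = Within-sym bypass }
  where
  open Bypassed B
  swap : ∀ {A B C : Set} → A ⊎ B ⊎ C → A ⊎ C ⊎ B
  swap (inj₁ x)        = inj₁ x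
  swap (inj₂ (inj₁ x)) = inj₂ (inj₂ x)
  swap (inj₂ (inj₂ x)) = inj₂ (inj₁ x)

removeEdge-bypassed : ∀ {n} (G : Graph n) {u v w} → adj G u w ≡ true → adj G w v ≡ true →
                      Bypassed G (removeEdge G u v) u v
removeEdge-bypassed G {u} {v} {w} uw wv = record
  { H⊆G    = removeEdge-⊆ G u v
  ; split  = removeEdge-split G u v
  ; bypass = step uw-kept (step wv-kept here)
  }
  where
  u≢w : u ≢ w
  u≢w = adj⇒≢ G uw
  w≢v : w ≢ v
  w≢v = adj⇒≢ G wv
  uw-kept : adj (removeEdge G u v) u w ≡ true
  uw-kept with removeEdge-split G u v u w uw
  ... | inj₁ e                 = e
  ... | inj₂ (inj₁ (_ , w≡v))  = ⊥-elim (w≢v w≡v)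
  ... | inj₂ (inj₂ (_ , w≡u))  = ⊥-elim (u≢w (≡-sym w≡u))
  wv-kept : adj (removeEdge G u v) w v ≡ true
  wv-kept with removeEdge-split G u v w v wv
  ... | inj₁ e                 = e
  ... | inj₂ (inj₁ (w≡u , _))  = ⊥-elim (u≢w (≡-sym w≡u))
  ... | inj₂ (inj₂ (w≡v , _))  = ⊥-elim (w≢v w≡v)

-- Encodes a walk crossing the deleted edge once, from `u` to `v`; the `suc` pays for the crossing.
Through : ∀ {n} → Graph n → Fin n → Fin n → ℕ → Fin n → Fin n → Set
Through H u v l x y = ∃ λ i → ∃ λ j → i + suc j ≤ l × Within H i x u × Within H j v y

module _ {n} {G H : Graph n} {u v} (B : Bypassed G H u v) where
  open Bypassed B

  -- Repeated crossings can be cut out. If the walk starts with a crossing and crosses again later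
  -- in the same direction, the loop in between is dropped; if it crosses back, it is again at its
  -- start and only the rest is kept.
  avoid-or-through : ∀ {l x y} → Within G l x y →
    Within H l x y ⊎ Through H u v l x y ⊎ Through H v u l x y
  avoid-or-through here = inj₁ here
  avoid-or-through (step {x = x} {z} e p) with split x z e | avoid-or-through p
  ... | inj₁ f | inj₁ q = inj₁ (step f q)
  ... | inj₁ f | inj₂ (inj₁ (i , j , le , q , r)) = inj₂ (inj₁ (suc i , j , s≤s le , step f q , r))
  ... | inj₁ f | inj₂ (inj₂ (i , j , le , q , r)) = inj₂ (inj₂ (suc i , j , s≤s le , step f q , r))
  ... | inj₂ (inj₁ (refl , refl)) | inj₁ q = inj₂ (inj₁ (0 , _ , ≤-refl , here , q))
  ... | inj₂ (inj₁ (refl , refl)) | inj₂ (inj₁ (i , j , le , _ , r)) =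
    inj₂ (inj₁ (0 , j , s≤s (<⇒≤ (m+n≤o⇒n≤o i le)) , here , r))
  ... | inj₂ (inj₁ (refl , refl)) | inj₂ (inj₂ (i , j , le , _ , r)) =
    inj₁ (Within-weaken (m≤n⇒m≤1+n (<⇒≤ (m+n≤o⇒n≤o i le))) r)
  ... | inj₂ (inj₂ (refl , refl)) | inj₁ q = inj₂ (inj₂ (0 , _ , ≤-refl , here , q))
  ... | inj₂ (inj₂ (refl , refl)) | inj₂ (inj₂ (i , j , le , _ , r)) =
    inj₂ (inj₂ (0 , j , s≤s (<⇒≤ (m+n≤o⇒n≤o i le)) , here , r))
  ... | inj₂ (inj₂ (refl , refl)) | inj₂ (inj₁ (i , j , le , _ , r)) =
    inj₁ (Within-weaken (m≤n⇒m≤1+n (<⇒≤ (m+n≤o⇒n≤o i le))) r)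

  module _ {i j k K x y} (long : i + suc j ≤ k) (k≤K : k ≤ K)
           (xu : Within H i x u) (vy : Within H j v y) (far : ¬ Within H k x y) where

    -- Prefixed by the walk from `x` to `u`, such a walk would bring `x` within `k` of `y` in `H`.
    no-shortcut : ∀ {t} → t ≤ suc j → ¬ Within H t u y
    no-shortcut t≤ q = far (Within-weaken (≤-trans (+-monoʳ-≤ i t≤) long) (Within-trans xu q))

    -- The bypass costs one step more than the edge, and the detour must still exceed `k`. Together
    -- with `long` this makes the path exactly `k` long.
    through-tight : k < i + (2 + j)
    through-tight = ≰⇒> λ le → far (Within-weaken le (Within-trans xu (Within-trans bypass vy)))

    -- The radius is `suc p`. Any other neighbour of `u` this close to `z` would let `u` reach `z`,
    -- and then `y`, inside `H` in at most `suc j` steps, which `no-shortcut` excludes.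
    gate-on-path : ∀ {p q z} → suc p + q ≤ j → Within H (suc p) v z → Within H q z y → Gate G K u v z
    gate-on-path {p} {q} {z} p+q≤j vz zy =
      z≢v , fromℕ< p<K ,
      subst (λ r → Within G r v z) (≡-sym (toℕ-fromℕ< p<K)) (Within-⊆ H⊆G vz) ,
      λ v′ uv′ w → only-v v′ uv′ (subst (λ r → Within G r v′ z) (toℕ-fromℕ< p<K) w)
      where
      p<K : suc p < K
      p<K = ≤-trans (s≤s (≤-trans (m≤m+n (suc p) q) p+q≤j))
                    (≤-trans (m≤n+m (suc j) i) (≤-trans long k≤K))
      z≢v : z ≢ v
      z≢v refl = no-shortcut (s≤s (≤-trans (s≤s (m≤n+m q p)) p+q≤j)) (Within-trans bypass zy)
      only-v : ∀ v′ → adj G u v′ ≡ true → Within G (suc p) v′ z → v′ ≡ v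
      only-v v′ uv′ v′z with split u v′ uv′
      ... | inj₂ (inj₁ (_ , v′≡v))   = v′≡v
      ... | inj₂ (inj₂ (u≡v , v′≡u)) = trans v′≡u u≡v
      ... | inj₁ uv′∈H with avoid-or-through v′z
      ...   | inj₁ q′ = ⊥-elim (no-shortcut (s≤s p+q≤j) (step uv′∈H (Within-trans q′ zy)))
      -- Having crossed the edge, the walk has at most `p` steps left from `v`; the step saved pays
      -- for the bypass.
      ...   | inj₂ (inj₁ (i′ , j′ , le , _ , vz′)) = ⊥-elim (no-shortcut
        (s≤s (≤-trans (+-monoˡ-≤ q (m+n≤o⇒n≤o i′ le)) p+q≤j))
        (Within-trans bypass (Within-trans vz′ zy)))
      ...   | inj₂ (inj₂ (i′ , j′ , le , _ , uz)) = ⊥-elim (no-shortcut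
        (m≤n⇒m≤1+n (≤-trans (+-monoˡ-≤ q (<⇒≤ (m+n≤o⇒n≤o i′ le))) p+q≤j))
        (Within-trans uz zy))

indicator : ∀ {A : Set} (d : Dec A) → A → 1 ≤ b2n ⌊ d ⌋
indicator (yes _) _ = s≤s z≤n
indicator (no ¬x) x = ⊥-elim (¬x x)

gates-positive : ∀ {n} {G : Graph n} {K u v z} → Gate G K u v z → 1 ≤ gates G K u v
gates-positive {G = G} {K} {u} {v} {z} g =
  ≤-trans (indicator (gate? G K u v z) g) (term≤Σv (λ z → b2n ⌊ gate? G K u v z ⌋) z)

gates≥2 : ∀ {n} {G : Graph n} {K u v y z} → y ≢ z →
          Gate G K u v y → Gate G K u v z → 2 ≤ gates G K u v
gates≥2 {G = G} {K} {u} {v} {y} {z} y≢z g h = ≤-trans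
  (+-mono-≤ (indicator (gate? G K u v y) g) (indicator (gate? G K u v z) h))
  (two-terms≤Σv (λ z → b2n ⌊ gate? G K u v z ⌋) y≢z)

-- The targets used are the end `y` and, for `j` at least 2, the first vertex after `v`. Two gates
-- suffice later, hence the truncation.
gates-through : ∀ {n} {G H : Graph n} {u v i j k K x y} → Bypassed G H u v →
  i + suc j ≤ k → k ≤ K → Within H i x u → Within H j v y → ¬ Within H k x y →
  2 ⊓ j ≤ gates G K u v
gates-through {j = zero} B long k≤K xu vy far = z≤n
gates-through {j = suc zero} B long k≤K xu vy far =
  gates-positive (gate-on-path B long k≤K xu vy far {p = 0} (s≤s z≤n) vy here)
-- If the walk ended at once, `v` would be a gate towards itself.
gates-through {j = suc (suc j)} B long k≤K xu here far =
  ⊥-elim (proj₁ (gate-on-path B long k≤K xu here far {p = 0} {q = 0} (s≤s z≤n) here here) refl)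
gates-through {j = suc (suc j)} B long k≤K xu (step {z = z} e zy) far =
  gates≥2 z≢y (gate-on-path B long k≤K xu vy far {p = 0} ≤-refl (step e here) zy)
              (gate-on-path B long k≤K xu vy far (≤-reflexive (+-identityʳ _)) vy here)
  where
  vy = step e zy
  z≢y : z ≢ _
  -- Otherwise the bypass and one further edge would lead from `u` to `y` in 3 steps.
  z≢y refl = no-shortcut B long k≤K xu vy far (s≤s (s≤s (s≤s z≤n)))
               (Within-trans (Bypassed.bypass B) (step e here))

-- Read forwards, the path gives gates at `u`; read backwards, gates at `v`.
gates-along : ∀ {n} {G H : Graph n} {u v k K x y} → Bypassed G H u v → 3 ≤ k → k ≤ K →
  ¬ Within H k x y → Through H u v k x y → 2 ≤ gates G K u v + gates G K v u
gates-along {k = k} B 3≤k k≤K far (i , j , long , xu , vy) = ≤-trans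
  (enough i j (through-tight B long k≤K xu vy far))
  (+-mono-≤ (gates-through B long k≤K xu vy far)
            (gates-through (Bypassed-sym B) long′ k≤K (Within-sym vy) (Within-sym xu)
                           (far ∘ Within-sym)))
  where
  long′ : j + suc i ≤ k
  long′ = subst (_≤ k) (+-comm (suc i) j) (subst (_≤ k) (+-suc i j) long)
  -- Tightness and `3≤k` make i + j at least 2, so the truncated lengths also sum to at least 2.
  enough : ∀ i j → k < i + (2 + j) → 2 ≤ 2 ⊓ j + 2 ⊓ i
  enough zero          zero          k<2 = ⊥-elim (<⇒≱ k<2 (≤-trans (n≤1+n 2) 3≤k))
  enough zero          (suc zero)    k<3 = ⊥-elim (<⇒≱ k<3 3≤k)
  enough (suc zero)    zero          k<3 = ⊥-elim (<⇒≱ k<3 3≤k)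
  enough zero          (suc (suc j)) _   = s≤s (s≤s z≤n)
  enough (suc (suc i)) zero          _   = s≤s (s≤s z≤n)
  enough (suc i)       (suc j)       _   = +-mono-≤ {1} {_} {1} (s≤s z≤n) (s≤s z≤n)

critical⇒gates : ∀ {n} {G H : Graph n} {u v k K} → Bypassed G H u v → DiamLE G k →
  ¬ DiamLE H k → 3 ≤ k → k ≤ K → 2 ≤ gates G K u v + gates G K v u
critical⇒gates {G = G} {H} {u} {v} {k} {K} B G≤k H≰k 3≤k k≤K with ¬DiamLE⇒far-pair H k H≰k
... | x , y , far with avoid-or-through B (G≤k x y)
...   | inj₁ q        = ⊥-elim (far q)
...   | inj₂ (inj₁ t) = gates-along B 3≤k k≤K far t
...   | inj₂ (inj₂ t) = subst (2 ≤_) (+-comm (gates G K v u) _)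
                              (gates-along (Bypassed-sym B) 3≤k k≤K far t)

-- The degree-square bound for diameter-critical graphs

DiamLE-weaken : ∀ {n} {G : Graph n} {k l} → k ≤ l → DiamLE G k → DiamLE G l
DiamLE-weaken k≤l d x y = Within-weaken k≤l (d x y)

-- All gates must share one `K`, so a single edge supplies it. Without edges the default 0 is
-- vacuously correct.
critical⇒bounded : ∀ {n} (G : Graph n) → DiamCritical G →
  ∃ λ K → ∀ u v → adj G u v ≡ true → DiamLE G K
critical⇒bounded G critical with any? (λ u → any? λ v → adj G u v Bool.≟ true)
... | yes (u , v , uv) = proj₁ (critical u v uv) , λ _ _ _ → proj₁ (proj₂ (critical u v uv))
... | no no-edge       = 0 , λ u v uv → ⊥-elim (no-edge (u , v , uv))

critical⇒sumDegSq≤ : ∀ n (G : Graph n) → DiamCritical G → ¬ DiamLE G 2 → sumDegSq G ≤ n * edges G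
critical⇒sumDegSq≤ n G critical G≰2 with critical⇒bounded G critical
... | K , bounded = sumDegSq-bound (triangles≤coedges K many)
  where
  open Triangles G
  3≤ : ∀ {k} → DiamLE G k → 3 ≤ k
  3≤ G≤k = ≰⇒> λ k≤2 → G≰2 (DiamLE-weaken k≤2 G≤k)
  many : ∀ u w v → adj G u w ≡ true → adj G u v ≡ true → adj G w v ≡ true →
         2 ≤ gates G K u v + gates G K v u
  many u w v uw uv wv with critical u v uv
  ... | k , G≤k , H≰k with removeEdge-bypassed G uw wv | bounded u v uv | ≤-total k K
  ...   | B | G≤K | inj₁ k≤K = critical⇒gates B G≤k H≰k (3≤ G≤k) k≤K
  -- If the `k` of this edge exceeds `K`, then `K` replaces it: `H` within `K` would also be within
  -- `k`.
  ...   | B | G≤K | inj₂ K≤k = critical⇒gates B G≤K (H≰k ∘ DiamLE-weaken K≤k) (3≤ G≤K) ≤-refl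

-- Brooms

-- A path on the levels 0, …, k with the last vertex replaced by 1 + j copies: a tree, in which
-- nearly all edges are incident to the vertex on level k ∸ 1.
module Broom (k-1 : ℕ) (2≤k : 2 ≤ suc k-1) (j : ℕ) where

  k size : ℕ
  k    = suc k-1
  size = k + suc j

  -- Truncation places all indices from `k` on at level `k`; these are the `suc j` leaves.
  level : Fin size → ℕ
  level x = toℕ x ⊓ k

  broom : Graph size
  broom = record
    { adj    = λ x y → ⌊ suc (level x) ℕ.≟ level y ⌋ ∨ ⌊ suc (level y) ℕ.≟ level x ⌋
    ; sym    = λ x y → Bool.∨-comm ⌊ suc (level x) ℕ.≟ level y ⌋ _
    ; irrefl = λ x → no-loop (level x)
    }
    where
    no-loop : ∀ l → ⌊ suc l ℕ.≟ l ⌋ ∨ ⌊ suc l ℕ.≟ l ⌋ ≡ false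
    no-loop l with suc l ℕ.≟ l
    ... | no _  = refl
    ... | yes p = ⊥-elim (1+n≢n p)

  adj⇒levels : ∀ x y → adj broom x y ≡ true → suc (level x) ≡ level y ⊎ suc (level y) ≡ level x
  adj⇒levels x y e with suc (level x) ℕ.≟ level y | suc (level y) ℕ.≟ level x
  ... | yes p | _     = inj₁ p
  ... | no _  | yes p = inj₂ p

  levels⇒adj : ∀ {x y} → suc (level x) ≡ level y → adj broom x y ≡ true
  levels⇒adj {x} {y} p with suc (level x) ℕ.≟ level y
  ... | yes _ = refl
  ... | no ¬p = ⊥-elim (¬p p)

  level≤k : ∀ x → level x ≤ k
  level≤k x = m⊓n≤n (toℕ x) k

  at : ∀ {i} → i ≤ k → Fin size
  at i≤k = fromℕ< (≤-trans (s≤s i≤k) (≤-trans (s≤s (m≤m+n k j)) (≤-reflexive (≡-sym (+-suc k j)))))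

  level-at : ∀ {i} (i≤k : i ≤ k) → level (at i≤k) ≡ i
  level-at i≤k = trans (cong (_⊓ k) (toℕ-fromℕ< _)) (m≤n⇒m⊓n≡m i≤k)

  level<k⇒toℕ : ∀ {x} → level x < k → toℕ x ≡ level x
  level<k⇒toℕ {x} l<k with ≤-total (toℕ x) k
  ... | inj₁ x≤k = ≡-sym (m≤n⇒m⊓n≡m x≤k)
  ... | inj₂ k≤x = ⊥-elim (<-irrefl (m≥n⇒m⊓n≡n k≤x) l<k)

  level-injective : ∀ {x y} → level x < k → level x ≡ level y → x ≡ y
  level-injective {x} {y} l<k eq = toℕ-injective
    (trans (level<k⇒toℕ l<k) (trans eq (≡-sym (level<k⇒toℕ (subst (_< k) eq l<k)))))

  -- Intermediate levels are crossed at their representatives `at`; only the last step aims at `y`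
  -- itself.
  ascend : ∀ d {x y} → suc (level x) + d ≡ level y → Within broom (suc d) x y
  ascend zero    eq = step (levels⇒adj (trans (≡-sym (+-identityʳ _)) eq)) here
  ascend (suc d) {x} {y} eq = step {z = z} (levels⇒adj (≡-sym (level-at l<k)))
    (ascend d (trans (cong (λ l → suc l + d) (level-at l<k))
                     (trans (≡-sym (+-suc _ d)) eq)))
    where
    l<k : suc (level x) ≤ k
    l<k = ≤-trans (m≤m+n _ (suc d)) (≤-trans (≤-reflexive eq) (level≤k y))
    z = at l<k

  climb : ∀ {x y} → level x < level y → Within broom k x y
  climb {x} {y} x<y with m≤n⇒∃[o]m+o≡n x<y
  ... | d , eq = Within-weaken
    (≤-trans (s≤s (m≤n+m d (level x))) (≤-trans (≤-reflexive eq) (level≤k y))) (ascend d eq)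

  siblings : ∀ {x y} i → suc i ≡ level x → suc i ≡ level y → Within broom 2 x y
  siblings {x} {y} i x-level y-level =
    Within-trans (Within-sym (step {ℓ = 0} {x = z} (levels⇒adj (up x-level)) here))
                 (step {ℓ = 0} {x = z} (levels⇒adj (up y-level)) here)
    where
    i≤k : i ≤ k
    i≤k = ≤-trans (n≤1+n i) (≤-trans (≤-reflexive x-level) (level≤k x))
    z = at i≤k
    up : ∀ {l} → suc i ≡ l → suc (level z) ≡ l
    up = trans (cong suc (level-at i≤k))

  diam≤k : DiamLE broom k
  diam≤k x y with <-cmp (level x) (level y)
  ... | tri< x<y _ _ = climb x<y
  ... | tri> _ _ y<x = Within-sym (climb y<x)
  ... | tri≈ _ x≡y _ with level x in eq
  ...   | suc i = Within-weaken 2≤k (siblings i (≡-sym eq) x≡y)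
  ...   | zero with level-injective {x} {y} (subst (_< k) (≡-sym eq) (s≤s z≤n)) (trans eq x≡y)
  ...     | refl = here

  -- An edge changes the level by 1, so level differences bound distances from below; levels 0 and
  -- `k` then show that the diameter is no smaller than `k`.
  level-Lipschitz : ∀ {l x y} → Within broom l x y → level y ≤ level x + l
  level-Lipschitz here = m≤m+n _ _
  level-Lipschitz {suc l} {x} {y} (step {z = z} e p) = begin
    level y              ≤⟨ level-Lipschitz p ⟩
    level z + l          ≤⟨ +-monoˡ-≤ l (one-step (adj⇒levels x z e)) ⟩
    suc (level x) + l    ≡⟨ +-suc (level x) l ⟨
    level x + suc l      ∎
    where
    open ≤-Reasoning
    one-step : suc (level x) ≡ level z ⊎ suc (level z) ≡ level x → level z ≤ suc (level x)
    one-step (inj₁ p) = ≤-reflexive (≡-sym p)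
    one-step (inj₂ p) = ≤-trans (n≤1+n _) (≤-trans (≤-reflexive p) (n≤1+n _))

  diam≰k-1 : ¬ DiamLE broom k-1
  diam≰k-1 d with level-Lipschitz (d (at {0} z≤n) (at {k} ≤-refl))
  ... | le rewrite level-at {0} z≤n | level-at {k} ≤-refl = 1+n≰n le

  -- A vertex has at most one neighbour on the level below, so the only broom edge leaving `Above`
  -- is `v u`, which `H` lacks.
  separated : ∀ {H u v} → (∀ x y → adj H x y ≡ true → adj broom x y ≡ true) →
    adj H v u ≡ false → suc (level u) ≡ level v → ∀ {l} → ¬ Within H l v u
  separated {H} {u} {v} H⊆ vu uv = stuck (inj₁ refl)
    where
    Above : Fin size → Set
    Above x = x ≡ v ⊎ level v < level x
    u<v : level u < level v
    u<v = ≤-reflexive uv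
    closed : ∀ {x y} → Above x → adj H x y ≡ true → Above y
    closed {x} {y} A e with A | adj⇒levels x y (H⊆ x y e)
    ... | inj₁ refl | inj₁ up   = inj₂ (≤-reflexive up)
    ... | inj₁ refl | inj₂ down with level-injective {y} {u}
            (≤-trans (≤-reflexive down) (level≤k v)) (suc-injective (trans down (≡-sym uv)))
    ...   | refl with trans (≡-sym e) vu
    ...     | ()
    closed {x} {y} A e | inj₂ v<x | inj₁ up   = inj₂ (≤-trans v<x (<⇒≤ (≤-reflexive up)))
    closed {x} {y} A e | inj₂ v<x | inj₂ down
      -- Being below `x`, the vertex `y` is under level `k` and alone on its level; if that is the
      -- level of `v`, it is `v`.
      with m≤n⇒m<n∨m≡n (s≤s⁻¹ (≤-trans v<x (≤-reflexive (≡-sym down))))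
    ...   | inj₁ v<y = inj₂ v<y
    ...   | inj₂ v≡y = inj₁ (level-injective (≤-trans (≤-reflexive down) (level≤k x)) (≡-sym v≡y))
    stuck : ∀ {l x} → Above x → ¬ Within H l x u
    stuck (inj₁ refl) here       = <-irrefl refl u<v
    stuck (inj₂ v<u)  here       = <-asym u<v v<u
    stuck A           (step e p) = stuck (closed A e) p

  -- Every edge is a bridge, so its removal leaves two vertices with no walk between them, of length
  -- at most `k` or any other.
  critical : DiamCritical broom
  critical u v e = k , diam≤k , increases
    where
    H = removeEdge broom u v
    increases : ¬ DiamLE H k
    increases d with adj⇒levels u v e
    ... | inj₁ up   = separated {H} (removeEdge-⊆ broom u v)
                        (trans (sym H v u) (removeEdge-removed broom u v)) up (d v u)
    ... | inj₂ down = separated {H} (removeEdge-⊆ broom u v)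
                        (removeEdge-removed broom u v) down (d u v)

  -- Each edge is charged to its upper end, which has at most one neighbour on the level below.
  edges≤size : edges broom ≤ size
  edges≤size = begin
    Σv (λ x → Σv (up x))             ≡⟨ Σv-swap up ⟩
    Σv (λ y → Σv (λ x → up x y))     ≤⟨ Σv-mono (λ y → Σv-subsingleton (λ x → up x y)
                                          (λ x → up≤1 x y)
                                          (λ x x′ p q → unique {x} {x′} {y} (up-positive {x} p) (up-positive {x′} q))) ⟩
    Σv {size} (λ _ → 1)              ≡⟨ Σv-const {size} 1 ⟩
    size * 1                         ≡⟨ *-identityʳ size ⟩
    size                             ∎
    where
    open ≤-Reasoning
    up : Fin size → Fin size → ℕ
    up x y = if toℕ x <ᵇ toℕ y then b2n (adj broom x y) else 0
    up≤1 : ∀ x y → up x y ≤ 1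
    up≤1 x y with toℕ x <ᵇ toℕ y | adj broom x y
    ... | false | _     = z≤n
    ... | true  | false = z≤n
    ... | true  | true  = s≤s z≤n
    up-positive : ∀ {x y} → 0 < up x y → suc (level x) ≡ level y
    up-positive {x} {y} p with toℕ x <ᵇ toℕ y in x<y | adj broom x y in e
    ... | true | true with adj⇒levels x y e
    ...   | inj₁ q = q
    -- A larger index never has a smaller level, so the edge cannot descend.
    ...   | inj₂ q = ⊥-elim (<⇒≱ (≤-reflexive q)
                       (⊓-monoˡ-≤ k (<⇒≤ (<ᵇ⇒< (toℕ x) (toℕ y) (subst T (≡-sym x<y) _)))))
    unique : ∀ {x x′ y} → suc (level x) ≡ level y → suc (level x′) ≡ level y → x ≡ x′
    unique {y = y} p q =
      level-injective (≤-trans (≤-reflexive p) (level≤k y)) (suc-injective (trans p (≡-sym q)))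

  hub : Fin size
  hub = at (n≤1+n k-1)

  hub-degree : suc j ≤ deg broom hub
  hub-degree = count≤Σv k (λ w → b2n (adj broom hub w)) λ w k≤w →
    ≤-reflexive (≡-sym (cong b2n (levels⇒adj {hub} {w}
      (trans (cong suc (level-at (n≤1+n k-1))) (≡-sym (m≥n⇒m⊓n≡n k≤w))))))
    where
    count≤Σv : ∀ m {n} (f : Fin (m + n) → ℕ) → (∀ v → m ≤ toℕ v → 1 ≤ f v) → n ≤ Σv f
    count≤Σv zero {n} f 1≤f = subst (_≤ Σv f) (trans (Σv-const {n} 1) (*-identityʳ n))
                                    (Σv-mono λ v → 1≤f v z≤n)
    count≤Σv (suc m) f 1≤f rewrite Σv-suc f =
      ≤-trans (count≤Σv m (f ∘ suc) λ v m≤v → 1≤f (suc v) (s≤s m≤v)) (m≤n+m _ (f zero))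

  sumDegSq≥ : suc j * suc j ≤ sumDegSq broom
  sumDegSq≥ = ≤-trans (*-mono-≤ hub-degree hub-degree) (term≤Σv (λ v → deg broom v * deg broom v) hub)

-- Asymptotic edge-degree of brooms

square-ratio : ∀ t k s → t * (k * (2 + k)) ≤ s → 1 ≤ s → t * ((k + s) * (k + s)) ≤ suc t * (s * s)
square-ratio t k s large 1≤s = begin
  t * ((k + s) * (k + s))                   ≡⟨ expand t k s ⟩
  -- Using `1≤s` makes the whole excess over t s² a multiple of `s`, which `large` then absorbs into
  -- one further s².
  t * (k * (2 * s + k * 1)) + t * (s * s)   ≤⟨ +-monoˡ-≤ _ (*-monoʳ-≤ t (*-monoʳ-≤ k
                                                 (+-monoʳ-≤ (2 * s) (*-monoʳ-≤ k 1≤s)))) ⟩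
  t * (k * (2 * s + k * s)) + t * (s * s)   ≡⟨ cong (_+ t * (s * s)) (factor t k s) ⟩
  t * (k * (2 + k)) * s + t * (s * s)       ≤⟨ +-monoˡ-≤ _ (*-monoˡ-≤ s large) ⟩
  suc t * (s * s)                           ∎
  where
  open ≤-Reasoning
  expand : ∀ t k s → t * ((k + s) * (k + s)) ≡ t * (k * (2 * s + k * 1)) + t * (s * s)
  expand = solve-∀
  factor : ∀ t k s → t * (k * (2 * s + k * s)) ≡ t * (k * (2 + k)) * s
  factor = solve-∀

-- The hub alone accounts for the degree squares; it remains to compare (k + s)² with s² for s =
-- `suc j`.
broom-ratio : ∀ k-1 (2≤k : 2 ≤ suc k-1) t j → t * (suc k-1 * (2 + suc k-1)) ≤ j →
  let open Broom k-1 2≤k j in t * (size * edges broom) ≤ suc t * sumDegSq broom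
broom-ratio k-1 2≤k t j J≤j = begin
  t * (size * edges broom)    ≤⟨ *-monoʳ-≤ t (*-monoʳ-≤ size edges≤size) ⟩
  t * (size * size)           ≤⟨ square-ratio t k (suc j) (m≤n⇒m≤1+n J≤j) (s≤s z≤n) ⟩
  suc t * (suc j * suc j)     ≤⟨ *-monoʳ-≤ (suc t) sumDegSq≥ ⟩
  suc t * sumDegSq broom      ∎
  where
  open ≤-Reasoning
  open Broom k-1 2≤k j

theorem1p5 : (∀ (n : ℕ) (G : Graph n) → DiamCritical G → ¬ DiamLE G 2 →
    sumDegSq G ≤ n * edges G)
    ×
    (∀ (k : ℕ) → 3 ≤ k →
    Σ (ℕ → ℕ) λ N →
    Σ ((j : ℕ) → Graph (N j)) λ G →
    (∀ j → suc (N j) ≤ N (suc j))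
    × (∀ j → DiamKCritical k (G j))
    × (∀ t → ∃ λ J → ∀ j → J ≤ j →
    t * (N j * edges (G j)) ≤ suc t * sumDegSq (G j)))
theorem1p5 = critical⇒sumDegSq≤ , λ where
  (suc k-1) 3≤k → let open Broom k-1 (<⇒≤ 3≤k) in
    size , broom ,
    (λ j → ≤-reflexive (≡-sym (+-suc (suc k-1) (suc j)))) ,
    (λ j → critical j , diam≤k j , diam≰k-1 j) ,
    -- From this index on, the average edge-degree is at least t/(t + 1) times the number of
    -- vertices.
    (λ t → t * (suc k-1 * (2 + suc k-1)) , broom-ratio k-1 (<⇒≤ 3≤k) t)
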